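{- For every integer $n \ge 1$ with binary representation $n = \sum_{i \ge 0} b_i 2^i$, $b_i \in \{0,1\}$, let $B(n) = \sum_{i \ge 0} b_i p^i$, where $p$ is the smallest prime factor of $n$ (and $B(1) = 1$). Then $B(n) \equiv m(n-1) \pmod 2$ for all $n \ge 1$.
   Context: For a non-negative integer $k$, $s_2(k)$ denotes the number of ones in the binary expansion of $k$. Define $\bar{t}(k) = 1$ if $s_2(k)$ is even and $\bar{t}(k)=0$ if $s_2(k)$ is odd. The sequence $m(n)$, $n \ge 0$, is defined by $m(2k) = \bar{t}(k)$ and $m(2k+1) = 0$ for all $k \ge 0$. The sequence $B(n)$ is OEIS A092524 (the binary representation of $n$ interpreted in base $p$), indexed from $n=1$: $1,2,4,4,26,6,57,8,28,10,1343,\ldots$. -}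

module Defs where

open import Data.Bool.Base using (if_then_else_)
open import Data.Digit using (Expansion; 1b; toDigits)
open import Data.Fin.Base using (toℕ)
import Data.Fin.Properties as Fin
open import Data.List.Base using (length; filter; lookup; tabulate)
open import Data.Nat.Base
open import Data.Nat.Divisibility
open import Data.Nat.ListAction using (sum)
open import Data.Nat.Primality
open import Data.Nat.Properties using (+-identityʳ; +-suc; ≮⇒≥)
open import Data.Product.Base using (∃; _×_; _,_; proj₁)
open import Relation.Binary.PropositionalEquality using (_≡_; refl; sym; trans)
open import Relation.Nullary.Decidable using (does; yes; no)

-- Least significant bit first.
bits : ℕ → Expansion 2
bits n = proj₁ (toDigits 2 n)

s₂ : ℕ → ℕ
s₂ k = length (filter (Fin._≟ 1b) (bits k))

t̄ : ℕ → ℕ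
t̄ k = if does (2 ∣? s₂ k) then 1 else 0

m : ℕ → ℕ
m n = if does (2 ∣? n) then t̄ (n / 2) else 0

-- ∑ᵢ bᵢ pⁱ. The library's fromDigits does not apply, since it evaluates an
-- expansion only in the base that bounds its digits.
evalBits : ℕ → Expansion 2 → ℕ
evalBits p bs = sum (tabulate λ i → toℕ (lookup bs i) * p ^ toℕ i)

SmallestPrimeFactor : ℕ → ℕ → Set
SmallestPrimeFactor n p =
  Prime p × p ∣ n × (∀ {q} → Prime q → q ∣ n → p ≤ q)

smallestPrimeFactor : ∀ n → .{{NonTrivial n}} → ∃ (SmallestPrimeFactor n)
smallestPrimeFactor n@(2+ k) = search k 2 refl 2-rough
  where
  found : ∀ d → .{{NonTrivial d}} → d Rough n → d ∣ n → ∃ (SmallestPrimeFactor n)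
  found d rough d∣n = d , rough∧∣⇒prime rough d∣n , d∣n , λ q-prime q∣n →
    ≮⇒≥ λ q<d → rough
      (hasNonTrivialDivisor {{prime⇒nonTrivial q-prime}} q<d q∣n)

  search : ∀ j d → .{{NonTrivial d}} → d + j ≡ n → d Rough n →
           ∃ (SmallestPrimeFactor n)
  search zero    d        eq rough =
    found d rough (∣-reflexive (trans (sym (+-identityʳ d)) eq))
  search (suc j) d@(2+ _) eq rough with d ∣? n
  ... | yes d∣n = found d rough d∣n
  ... | no  d∤n =
    search j (suc d) (trans (sym (+-suc d j)) eq) (∤⇒rough-suc d∤n rough)

B : ∀ n → .{{NonZero n}} → ℕ
B 1        = 1
B n@(2+ _) = evalBits (proj₁ (smallestPrimeFactor n)) (bits n)

{-# OPTIONS --safe #-}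

-- If n is even, then p = 2, so B(n) = n is even, while m vanishes at the odd
-- number n − 1. If n = 2k + 1 with k ≥ 1, then p is odd, so all its powers are
-- odd and B(n) ≡ s₂(n) = 1 + s₂(k) ≡ t̄(k) = m(2k) modulo 2.
module Submission where

open import Data.Bool.Base using (if_then_else_)
open import Data.Digit using (Expansion; 1b; fromDigits; toDigits)
open import Data.Fin.Base using (Fin; zero; suc; toℕ)
import Data.Fin.Properties as Fin
open import Data.List.Base using ([]; _∷_; length; filter; lookup; tabulate)
open import Data.List.Properties using (tabulate-cong)
open import Data.Nat.Base using
  (ℕ; NonZero; zero; suc; 2+; _+_; _*_; _∸_; _^_; _/_; _%_; nonTrivial⇒n>1)
open import Data.Nat.Divisibility using
  (_∣_; _∤_; _∣?_; divides; divides-refl; ∣-trans; n∣m⇒m%n≡0)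
open import Data.Nat.DivMod using
  (_divMod_; result; [m+kn]%n≡m%n; m*n/n≡m; m*n%n≡0; %-distribˡ-+)
open import Data.Nat.ListAction using (sum)
open import Data.Nat.Primality using (prime[2]; prime⇒nonTrivial)
open import Data.Nat.Properties
open import Data.Product.Base using (∃; _,_; proj₂)
open import Function.Base using (_∘_)
open import Relation.Binary.PropositionalEquality
  using (_≡_; _≢_; refl; sym; trans; cong; cong₂; module ≡-Reasoning)
open import Relation.Nullary.Decidable using (does; yes; no; dec-true; dec-false)
open import Relation.Nullary.Negation using (contradiction)
open import Defs

open ≡-Reasoning

sum-tabulate-*ʳ : ∀ {k} (f : Fin k → ℕ) c →
                  sum (tabulate λ i → f i * c) ≡ sum (tabulate f) * c
sum-tabulate-*ʳ {zero}  f c = refl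
sum-tabulate-*ʳ {suc k} f c = begin
  f zero * c + sum (tabulate λ i → f (suc i) * c)  ≡⟨ cong (f zero * c +_) (sum-tabulate-*ʳ (f ∘ suc) c) ⟩
  f zero * c + sum (tabulate (f ∘ suc)) * c        ≡⟨ *-distribʳ-+ c (f zero) _ ⟨
  (f zero + sum (tabulate (f ∘ suc))) * c          ∎

-- Horner's rule: passing to the tail shifts every index by one, so a factor `p` comes out of the
-- remaining sum. This is the recursion by which `fromDigits` evaluates, and it opens the positional
-- sum to induction on the digits.
evalBits-∷ : ∀ p d ds → evalBits p (d ∷ ds) ≡ toℕ d + evalBits p ds * p
evalBits-∷ p d ds = cong₂ _+_ (*-identityʳ (toℕ d)) (begin
  sum (tabulate λ i → toℕ (lookup ds i) * (p * p ^ toℕ i))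
    ≡⟨ cong sum (tabulate-cong λ i → trans
         (cong (toℕ (lookup ds i) *_) (*-comm p (p ^ toℕ i)))
         (sym (*-assoc (toℕ (lookup ds i)) (p ^ toℕ i) p))) ⟩
  sum (tabulate λ i → toℕ (lookup ds i) * p ^ toℕ i * p)
    ≡⟨ sum-tabulate-*ʳ (λ i → toℕ (lookup ds i) * p ^ toℕ i) p ⟩
  evalBits p ds * p ∎)

evalBits-2 : ∀ ds → evalBits 2 ds ≡ fromDigits ds
evalBits-2 []       = refl
evalBits-2 (d ∷ ds) = trans (evalBits-∷ 2 d ds) (cong (λ x → toℕ d + x * 2) (evalBits-2 ds))

ones : Expansion 2 → ℕ
ones ds = length (filter (Fin._≟ 1b) ds)

ones-∷ : ∀ d ds → ones (d ∷ ds) ≡ toℕ d + ones ds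
ones-∷ zero       ds = refl
ones-∷ (suc zero) ds = refl

-- An odd base is 1 modulo 2, so each Horner step adds its digit and preserves the parity of the
-- rest: `e * p` is `e` plus the even number `e * (j * 2)`.
evalBits-odd : ∀ j ds → evalBits (1 + j * 2) ds % 2 ≡ ones ds % 2
evalBits-odd j []       = refl
evalBits-odd j (d ∷ ds) = begin
  evalBits p (d ∷ ds) % 2          ≡⟨ cong (_% 2) (evalBits-∷ p d ds) ⟩
  (toℕ d + e * p) % 2              ≡⟨ cong (λ x → (toℕ d + x) % 2) (*-suc e (j * 2)) ⟩
  (toℕ d + (e + e * (j * 2))) % 2  ≡⟨ cong (_% 2) (+-assoc (toℕ d) e _) ⟨
  (toℕ d + e + e * (j * 2)) % 2    ≡⟨ cong (λ x → (toℕ d + e + x) % 2) (*-assoc e j 2) ⟨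
  (toℕ d + e + e * j * 2) % 2      ≡⟨ [m+kn]%n≡m%n (toℕ d + e) (e * j) 2 ⟩
  -- The sum is split into residues because the induction hypothesis determines `e` only modulo 2.
  (toℕ d + e) % 2                  ≡⟨ %-distribˡ-+ (toℕ d) e 2 ⟩
  (toℕ d % 2 + e % 2) % 2          ≡⟨ cong (λ x → (toℕ d % 2 + x) % 2) (evalBits-odd j ds) ⟩
  (toℕ d % 2 + ones ds % 2) % 2    ≡⟨ %-distribˡ-+ (toℕ d) (ones ds) 2 ⟨
  (toℕ d + ones ds) % 2            ≡⟨ cong (_% 2) (ones-∷ d ds) ⟨
  ones (d ∷ ds) % 2                ∎
  where
  p = 1 + j * 2
  e = evalBits p ds

odd≢even : ∀ a b → 1 + a * 2 ≢ b * 2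
odd≢even a b eq with () ← begin
  1                ≡⟨ [m+kn]%n≡m%n 1 a 2 ⟨
  (1 + a * 2) % 2  ≡⟨ cong (_% 2) eq ⟩
  b * 2 % 2        ≡⟨ m*n%n≡0 b 2 ⟩
  0                ∎

-- Expansions of the same number may still differ by leading zeros.
ones-unique : ∀ ds es → fromDigits ds ≡ fromDigits es → ones ds ≡ ones es
ones-unique []              []              eq = refl
ones-unique []              (zero ∷ es)     eq = ones-unique [] es (*-cancelʳ-≡ 0 (fromDigits es) 2 eq)
ones-unique (zero ∷ ds)     []              eq = ones-unique ds [] (*-cancelʳ-≡ (fromDigits ds) 0 2 eq)
ones-unique (zero ∷ ds)     (zero ∷ es)     eq = ones-unique ds es (*-cancelʳ-≡ (fromDigits ds) _ 2 eq)
ones-unique (suc zero ∷ ds) (suc zero ∷ es) eq =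
  cong suc (ones-unique ds es (*-cancelʳ-≡ (fromDigits ds) _ 2 (suc-injective eq)))
ones-unique (zero ∷ ds)     (suc zero ∷ es) eq = contradiction (sym eq) (odd≢even (fromDigits es) (fromDigits ds))
ones-unique (suc zero ∷ ds) (zero ∷ es)     eq = contradiction eq (odd≢even (fromDigits ds) (fromDigits es))

fromDigits-bits : ∀ n → fromDigits (bits n) ≡ n
fromDigits-bits n = proj₂ (toDigits 2 n)

-- Prefixing `1b` to `bits k` gives a second expansion of the same number, and equal values force
-- equally many ones.
s₂-odd : ∀ k → s₂ (1 + k * 2) ≡ suc (s₂ k)
s₂-odd k = ones-unique (bits (1 + k * 2)) (1b ∷ bits k) (begin
  fromDigits (bits (1 + k * 2))  ≡⟨ fromDigits-bits (1 + k * 2) ⟩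
  1 + k * 2                      ≡⟨ cong (λ x → 1 + x * 2) (fromDigits-bits k) ⟨
  1 + fromDigits (bits k) * 2    ∎)

suc-parity : ∀ s → suc s % 2 ≡ (if does (2 ∣? s) then 1 else 0) % 2
suc-parity zero       = refl
suc-parity (suc zero) = refl
-- Remainders modulo 2 compute with period two, so both sides reduce to their values at `s`.
suc-parity (2+ s)     = suc-parity s

m-even : ∀ k → m (k * 2) ≡ t̄ k
m-even k = begin
  m (k * 2)      ≡⟨ cong (if_then t̄ (k * 2 / 2) else 0) (dec-true (2 ∣? k * 2) (divides-refl k)) ⟩
  t̄ (k * 2 / 2)  ≡⟨ cong t̄ (m*n/n≡m k 2) ⟩
  t̄ k            ∎

m-odd : ∀ k → m (1 + k * 2) ≡ 0
m-odd k = cong (if_then t̄ ((1 + k * 2) / 2) else 0)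
  (dec-false (2 ∣? 1 + k * 2) λ { (divides q eq) → odd≢even k q eq })

odd-form : ∀ {n} → 2 ∤ n → ∃ λ j → n ≡ 1 + j * 2
odd-form {n} 2∤n with n divMod 2
... | result q zero       eq = contradiction (divides q eq) 2∤n
... | result q (suc zero) eq = q , eq

-- Minimality against the prime divisor 2 gives `p ≤ 2`, and every prime exceeds 1.
smallestPrimeFactor-even : ∀ {n p} → 2 ∣ n → SmallestPrimeFactor n p → p ≡ 2
smallestPrimeFactor-even {p = p} 2∣n (p-prime , _ , least) =
  ≤-antisym (least prime[2] 2∣n) (nonTrivial⇒n>1 p {{prime⇒nonTrivial p-prime}})

lemma6 : ∀ (n : ℕ) → .{{_ : NonZero n}} → B n % 2 ≡ m (n ∸ 1) % 2
-- Here `m 0` is `t̄ 0`, which is 1 because 0 has no binary ones.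
lemma6 1 = refl
lemma6 n@(2+ n-2) with smallestPrimeFactor n | 2 ∣? n
-- The quotient is a successor since `n` is positive, which puts `n ∸ 1` in the odd form
-- `1 + k * 2`.
... | p , spf | yes 2∣n@(divides (suc k) n≡2+k*2)
  rewrite smallestPrimeFactor-even 2∣n spf = begin
  evalBits 2 (bits n) % 2  ≡⟨ cong (_% 2) (evalBits-2 (bits n)) ⟩
  fromDigits (bits n) % 2  ≡⟨ cong (_% 2) (fromDigits-bits n) ⟩
  n % 2                    ≡⟨ n∣m⇒m%n≡0 n 2 2∣n ⟩
  0                        ≡⟨ cong (_% 2) (m-odd k) ⟨
  m (1 + k * 2) % 2        ≡⟨ cong (λ x → m x % 2) (suc-injective n≡2+k*2) ⟨
  m (n ∸ 1) % 2            ∎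
... | p , _ , p∣n , _ | no 2∤n
  -- An even `p` would make its multiple `n` even, so `p` has the odd form that `evalBits-odd`
  -- expects.
  with j , refl ← odd-form {p} (λ 2∣p → 2∤n (∣-trans 2∣p p∣n))
     | k , n≡1+k*2 ← odd-form 2∤n = begin
  evalBits p (bits n) % 2  ≡⟨ evalBits-odd j (bits n) ⟩
  s₂ n % 2                 ≡⟨ cong (λ x → s₂ x % 2) n≡1+k*2 ⟩
  s₂ (1 + k * 2) % 2       ≡⟨ cong (_% 2) (s₂-odd k) ⟩
  suc (s₂ k) % 2           ≡⟨ suc-parity (s₂ k) ⟩
  t̄ k % 2                  ≡⟨ cong (_% 2) (m-even k) ⟨
  m (k * 2) % 2            ≡⟨ cong (λ x → m x % 2) (suc-injective n≡1+k*2) ⟨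
  m (n ∸ 1) % 2            ∎
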